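{- Let $T$ be a monoidal monad on $\mathbf{Set}$ and let $m$ be a binary operation symbol of a signature $\Sigma$. If $T$ preserves the equation $m(x,x)=x$, then $T$ is relevant.
   Context: A monoidal monad on $\mathbf{Set}$ is a monad $(T,\eta,\mu)$ with a natural transformation $\psi_{X,Y}\colon TX\times TY\to T(X\times Y)$ making $T$ lax monoidal with unit $\psi^0=\eta_1$, such that $\eta,\mu$ are monoidal natural transformations (equivalently, a commutative monad with its double strength); $\psi^n$ is the $n$-ary version. For a $\Sigma$-algebra $\mathcal A$ on $A$, $\widehat T\mathcal A$ is the algebra on $TA$ with $\sigma_{\widehat T\mathcal A}=T\sigma_{\mathcal A}\circ\psi^{\mathrm{ar}(\sigma)}$. $T$ preserves an equation if $\widehat T\mathcal A$ satisfies it whenever $\mathcal A$ does. $T$ is relevant if $\psi_{A,A}\circ\Delta_{TA}=T\Delta_A$ for all sets $A$ (where $\Delta$ is the diagonal); equivalently $\psi_{A,B}\circ\chi_{A,B}=\mathrm{id}_{T(A\times B)}$ for all $A,B$, where $\chi_{A,B}=\langle T\pi_1,T\pi_2\rangle$. -}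

module Defs where

open import Level using (Level; suc; _⊔_)
open import Data.Nat using (ℕ)
open import Data.Product using (_×_; _,_; proj₁; proj₂; map; uncurry; assocʳ′)
open import Data.Unit.Polymorphic using (⊤; tt)
open import Data.Vec using (Vec; []; _∷_)
open import Function using (id; _∘_)
open import Relation.Binary.PropositionalEquality using (_≡_; _≗_)

private
  variable
    o v ℓ : Level

-- The category of sets is Set ℓ (types are sets by axiom K), where two
-- functions are the same morphism when they are pointwise equal.  Hence
-- a functor has to respect _≗_; with function extensionality fmap-cong
-- would hold automatically.

record Monad ℓ : Set (suc ℓ) where
  field
    F    : Set ℓ → Set ℓ
    fmap : ∀ {A B} → (A → B) → F A → F B
    η    : ∀ {A} → A → F A
    μ    : ∀ {A} → F (F A) → F A

    fmap-cong : ∀ {A B} {f g : A → B} → f ≗ g → fmap f ≗ fmap g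
    fmap-id   : ∀ {A} → fmap (id {A = A}) ≗ id
    fmap-∘    : ∀ {A B C} (g : B → C) (f : A → B) →
                fmap (g ∘ f) ≗ fmap g ∘ fmap f

    η-natural : ∀ {A B} (f : A → B) → fmap f ∘ η ≗ η ∘ f
    μ-natural : ∀ {A B} (f : A → B) → fmap f ∘ μ ≗ μ ∘ fmap (fmap f)

    μ-identityˡ : ∀ {A} → μ {A} ∘ η ≗ id
    μ-identityʳ : ∀ {A} → μ {A} ∘ fmap η ≗ id
    μ-assoc     : ∀ {A} → μ {A} ∘ fmap μ ≗ μ ∘ μ

record MonoidalMonad ℓ : Set (suc ℓ) where
  field
    monad : Monad ℓ

  open Monad monad public

  field
    ψ : ∀ {A B} → F A × F B → F (A × B)

    ψ-natural : ∀ {A B C D} (f : A → C) (g : B → D) →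
                fmap (map f g) ∘ ψ ≗ ψ ∘ map (fmap f) (fmap g)

  ψ⁰ : ⊤ → F ⊤
  ψ⁰ = η

  field
    -- (F , ψ , ψ⁰) is a lax monoidal functor.
    ψ-assoc     : ∀ {A B C} (s : F A) (t : F B) (u : F C) →
                  fmap assocʳ′ (ψ (ψ (s , t) , u)) ≡ ψ (s , ψ (t , u))
    ψ-identityˡ : ∀ {A} (t : F A) → fmap proj₂ (ψ (ψ⁰ tt , t)) ≡ t
    ψ-identityʳ : ∀ {A} (t : F A) → fmap proj₁ (ψ (t , ψ⁰ tt)) ≡ t

    -- η and μ are monoidal natural transformations.  Their compatibility
    -- with the unit maps follows from ψ⁰ = η and the monad laws.
    η-monoidal : ∀ {A B} (a : A) (b : B) → ψ (η a , η b) ≡ η (a , b)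
    μ-monoidal : ∀ {A B} (s : F (F A)) (t : F (F B)) →
                 μ (fmap ψ (ψ (s , t))) ≡ ψ (μ s , μ t)

  -- The n-ary version of ψ, with all n sets equal and X ^ n given by Vec X n.
  ψⁿ : ∀ {A n} → Vec (F A) n → F (Vec A n)
  ψⁿ []       = fmap (λ _ → []) (ψ⁰ tt)
  ψⁿ (t ∷ ts) = fmap (uncurry _∷_) (ψ (t , ψⁿ ts))

Δ : {A : Set ℓ} → A → A × A
Δ a = a , a

Relevant : MonoidalMonad ℓ → Set (suc ℓ)
Relevant {ℓ} T = ∀ (A : Set ℓ) → ψ ∘ Δ ≗ fmap (Δ {A = A})
  where open MonoidalMonad T

-- Sym n is the set of operation symbols of arity n.
record Signature o : Set (suc o) where
  field
    Sym : ℕ → Set o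

open Signature public

record Algebra (S : Signature o) ℓ : Set (o ⊔ suc ℓ) where
  field
    Carrier : Set ℓ
    ⟦_⟧     : ∀ {n} → Sym S n → Vec Carrier n → Carrier

data Term (S : Signature o) (V : Set v) : Set (o ⊔ v) where
  var : V → Term S V
  app : ∀ {n} → Sym S n → Vec (Term S V) n → Term S V

module _ {S : Signature o} {V : Set v} (𝒜 : Algebra S ℓ) where
  open Algebra 𝒜

  eval     : (V → Carrier) → Term S V → Carrier
  evalArgs : ∀ {n} → (V → Carrier) → Vec (Term S V) n → Vec Carrier n

  eval ρ (var x)    = ρ x
  eval ρ (app σ ts) = ⟦ σ ⟧ (evalArgs ρ ts)

  evalArgs ρ []       = []
  evalArgs ρ (t ∷ ts) = eval ρ t ∷ evalArgs ρ ts

infix 4 _≈_ _⊨_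

record Equation (S : Signature o) : Set o where
  constructor _≈_
  field
    lhs rhs : Term S ℕ

_⊨_ : {S : Signature o} → Algebra S ℓ → Equation S → Set ℓ
𝒜 ⊨ (l ≈ r) = ∀ ρ → eval 𝒜 ρ l ≡ eval 𝒜 ρ r

lift : {S : Signature o} → MonoidalMonad ℓ → Algebra S ℓ → Algebra S ℓ
lift T 𝒜 = record
  { Carrier = F Carrier
  ; ⟦_⟧     = λ σ → fmap ⟦ σ ⟧ ∘ ψⁿ
  }
  where
  open MonoidalMonad T
  open Algebra 𝒜

Preserves : {S : Signature o} → MonoidalMonad ℓ → Equation S → Set (o ⊔ suc ℓ)
Preserves {ℓ = ℓ} {S = S} T e = ∀ (𝒜 : Algebra S ℓ) → 𝒜 ⊨ e → lift T 𝒜 ⊨ e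

idempotence : (S : Signature o) → Sym S 2 → Equation S
idempotence S m = app m (x ∷ x ∷ []) ≈ x
  where x = var 0

{-# OPTIONS --safe #-}
-- Rectangular bands are idempotent: on B × B let m (x , y) = (π₁ x , π₂ y).
-- Idempotence of the lifted operation says ψ ∘ ⟨Tπ₁ , Tπ₂⟩ = id on T (B × B),
-- which gives relevance at B.  The remaining symbols of the signature may
-- include constants, so B must have a point.  To prove relevance at a possibly
-- empty A and s : T A, take B = T A, which has the point s, and transport
-- relevance from T A to A along the map T η, which is split by μ.
module Submission where

open import Defs
open import Data.Product using (_×_; _,_; proj₁; proj₂; map; uncurry)
open import Data.Unit.Polymorphic using (tt)
open import Data.Vec using (Vec; []; _∷_; [_])
open import Function using (id; _∘_; const)
open import Level using (Level)
open import Relation.Binary.PropositionalEquality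
  using (_≡_; refl; sym; trans; cong; cong₂; _≗_; module ≡-Reasoning)

private
  variable
    o ℓ : Level

-- The interpretation depends on the arity alone, so no symbol has to be compared with `m`.
rectangularBand : (S : Signature o) {B : Set ℓ} → B → Algebra S ℓ
rectangularBand S {B} b = record { Carrier = B × B ; ⟦_⟧ = λ _ → op }
  where
  op : ∀ {n} → Vec (B × B) n → B × B
  op []          = b , b
  op (x ∷ [])    = x
  op (x ∷ y ∷ _) = proj₁ x , proj₂ y

module _ (T : MonoidalMonad ℓ) where
  open MonoidalMonad T
  open ≡-Reasoning

  -- Naturality pulls `const []` out of `ψ`, and the right unit law then absorbs `ψ⁰ tt`.
  ψ¹ : ∀ {A} (t : F A) → ψⁿ (t ∷ []) ≡ fmap [_] t
  ψ¹ t = begin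
    fmap (uncurry _∷_) (ψ (t , fmap (const []) (ψ⁰ tt)))
      ≡⟨ cong (λ u → fmap (uncurry _∷_) (ψ (u , _))) (sym (fmap-id t)) ⟩
    fmap (uncurry _∷_) (ψ (map (fmap id) (fmap (const [])) (t , ψ⁰ tt)))
      ≡⟨ cong (fmap (uncurry _∷_)) (sym (ψ-natural id (const []) (t , ψ⁰ tt))) ⟩
    fmap (uncurry _∷_) (fmap (map id (const [])) (ψ (t , ψ⁰ tt)))
      ≡⟨ sym (fmap-∘ _ _ _) ⟩
    fmap ([_] ∘ proj₁) (ψ (t , ψ⁰ tt))
      ≡⟨ fmap-∘ _ _ _ ⟩
    fmap [_] (fmap proj₁ (ψ (t , ψ⁰ tt)))
      ≡⟨ cong (fmap [_]) (ψ-identityʳ t) ⟩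
    fmap [_] t ∎

  ψ² : ∀ {A} (t u : F A) →
       ψⁿ (t ∷ u ∷ []) ≡ fmap (λ (a , b) → a ∷ b ∷ []) (ψ (t , u))
  ψ² t u = begin
    fmap (uncurry _∷_) (ψ (t , ψⁿ (u ∷ [])))
      ≡⟨ cong (fmap (uncurry _∷_) ∘ ψ) (cong₂ _,_ (sym (fmap-id t)) (ψ¹ u)) ⟩
    fmap (uncurry _∷_) (ψ (map (fmap id) (fmap [_]) (t , u)))
      ≡⟨ cong (fmap (uncurry _∷_)) (sym (ψ-natural id [_] (t , u))) ⟩
    fmap (uncurry _∷_) (fmap (map id [_]) (ψ (t , u)))
      ≡⟨ sym (fmap-∘ _ _ _) ⟩
    fmap (λ (a , b) → a ∷ b ∷ []) (ψ (t , u)) ∎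

  RelevantAt : Set ℓ → Set ℓ
  RelevantAt A = ψ ∘ Δ ≗ fmap (Δ {A = A})

  -- The hypothesis is applied to `fmap Δ s`: both its marginals are `s`, as `Δ` is a section of
  -- each projection.
  ψχ≗id⇒relevantAt : ∀ {B} →
    (∀ (t : F (B × B)) → ψ (fmap proj₁ t , fmap proj₂ t) ≡ t) → RelevantAt B
  ψχ≗id⇒relevantAt ψχ≗id s = begin
    ψ (s , s)
      ≡⟨ cong ψ (sym (cong₂ _,_ (fmapΔ-section proj₁ (λ _ → refl))
                                (fmapΔ-section proj₂ (λ _ → refl)))) ⟩
    ψ (fmap proj₁ (fmap Δ s) , fmap proj₂ (fmap Δ s))
      ≡⟨ ψχ≗id (fmap Δ s) ⟩
    fmap Δ s ∎
    where
    fmapΔ-section : ∀ π → π ∘ Δ ≗ id → fmap π (fmap Δ s) ≡ s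
    fmapΔ-section π π∘Δ≗id =
      trans (sym (fmap-∘ π Δ s)) (trans (fmap-cong π∘Δ≗id s) (fmap-id s))

  preserves⇒ψχ≗id : (S : Signature o) (m : Sym S 2) →
    Preserves T (idempotence S m) → ∀ {B} → B →
    ∀ (t : F (B × B)) → ψ (fmap proj₁ t , fmap proj₂ t) ≡ t
  preserves⇒ψχ≗id S m preserves {B} b t = begin
    ψ (fmap proj₁ t , fmap proj₂ t)
      ≡⟨ sym (ψ-natural proj₁ proj₂ (t , t)) ⟩
    fmap (map proj₁ proj₂) (ψ (t , t))
      -- On two-element vectors `⟦ m ⟧` computes to `map proj₁ proj₂`, so the two sides differ only
      -- by functoriality.
      ≡⟨ fmap-∘ ⟦ m ⟧ _ _ ⟩
    fmap ⟦ m ⟧ (fmap (λ (x , y) → x ∷ y ∷ []) (ψ (t , t)))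
      ≡⟨ cong (fmap ⟦ m ⟧) (sym (ψ² t t)) ⟩
    fmap ⟦ m ⟧ (ψⁿ (t ∷ t ∷ []))
      -- The band is idempotent by eta for pairs.
      ≡⟨ preserves (rectangularBand S b) (λ _ → refl) (const t) ⟩
    t ∎
    where open Algebra (rectangularBand S b) using (⟦_⟧)

  -- With `s` written as `μ (fmap η s)`, monoidality of `μ` moves the duplication to `fmap η s`,
  -- where the hypothesis applies; monoidality of `η` then turns `ψ ∘ Δ ∘ η` into `η ∘ Δ`, and `μ`
  -- cancels `fmap η`.
  relevantAt-F⇒relevantAt : ∀ {A} → RelevantAt (F A) → RelevantAt A
  relevantAt-F⇒relevantAt relevant s = begin
    ψ (s , s)
      ≡⟨ cong (ψ ∘ Δ) (sym (μ-identityʳ s)) ⟩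
    ψ (μ (fmap η s) , μ (fmap η s))
      ≡⟨ sym (μ-monoidal (fmap η s) (fmap η s)) ⟩
    μ (fmap ψ (ψ (Δ (fmap η s))))
      ≡⟨ cong (μ ∘ fmap ψ) (relevant (fmap η s)) ⟩
    μ (fmap ψ (fmap Δ (fmap η s)))
      ≡⟨ cong (μ ∘ fmap ψ) (sym (fmap-∘ Δ η s)) ⟩
    μ (fmap ψ (fmap (Δ ∘ η) s))
      ≡⟨ cong μ (sym (fmap-∘ ψ (Δ ∘ η) s)) ⟩
    μ (fmap (ψ ∘ Δ ∘ η) s)
      ≡⟨ cong μ (fmap-cong (λ a → η-monoidal a a) s) ⟩
    μ (fmap (η ∘ Δ) s)
      ≡⟨ cong μ (fmap-∘ η Δ s) ⟩
    μ (fmap η (fmap Δ s))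
      ≡⟨ μ-identityʳ (fmap Δ s) ⟩
    fmap Δ s ∎

theorem5 : ∀ {o ℓ} (T : MonoidalMonad ℓ) (S : Signature o) (m : Sym S 2) → Preserves T (idempotence S m) → Relevant T
theorem5 T S m preserves A s =
  relevantAt-F⇒relevantAt T
    (ψχ≗id⇒relevantAt T (preserves⇒ψχ≗id T S m preserves s)) s
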